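{- Let $\Sigma$ be a signature, $\mathbf{K}$ a quasivariety of $\Sigma$-structures and $\tau$ a finite set of equations in at most one variable. For every $\Sigma$-structure $M$ define $$i^\tau_M:Co_{\mathbf{K}}(M)\to(\mathcal{P}(M),\subseteq),\qquad \theta\mapsto\{m\in M\mid \tau^M(m)\subseteq\theta\}.$$ Then $i^\tau=(i^\tau_M)_M$ is a natural transformation (i.e. $i^\tau_M\circ Co_{\mathbf{K}}(f)=f^{ -1}\circ i^\tau_N$ for every homomorphism $f:M\to N$), and for every $\Sigma$-structure $M$ the map $i^\tau_M$ preserves arbitrary infima and directed suprema; that is, $(Co_{\mathbf{K}},i^\tau)$ is a filter pair.
   Context: An equation in at most one variable $x$ is a pair $\langle\epsilon,\delta\rangle$ of $\Sigma$-terms in at most the variable $x$. For $m\in M$, $\tau^M(m)=\{\langle\epsilon^M(m),\delta^M(m)\rangle\mid\langle\epsilon,\delta\rangle\in\tau\}\subseteq M\times M$. $\Sigma$-Str is the category of $\Sigma$-structures and homomorphisms. $AL$ is the category of algebraic lattices with maps preserving arbitrary meets and directed joins. A filter pair over $\Sigma$ is a pair $(G,i)$ of a contravariant functor $G:\Sigma\text{ -Str}\to AL$ and maps $i_A:G(A)\to(\mathcal{P}(A),\subseteq)$, one for each $\Sigma$-structure $A$, preserving arbitrary infima (in particular $i_A(\top)=A$) and directed suprema, such that $i_A\circ G(h)=h^{ -1}\circ i_B$ for every homomorphism $h:A\to B$. A quasivariety is a class of $\Sigma$-structures axiomatizable by quasi-identities. $Co_{\mathbf{K}}(A)$ is the set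 of congruences $\theta$ on $A$ with $A/\theta\in\mathbf{K}$, ordered by inclusion (an algebraic lattice, since $\mathbf{K}$ is a quasivariety), and $Co_{\mathbf{K}}(f)=(f\times f)^{ -1}$ for a homomorphism $f$; this is a contravariant functor $\Sigma\text{ -Str}\to AL$. -}

module Defs where

open import Level using (Level; suc; _⊔_)
open import Data.List.Base using (List)
open import Data.List.Relation.Unary.All as All using (All)
open import Data.List.Relation.Unary.Any as Any using (Any)
open import Data.Nat.Base using (ℕ)
open import Data.Product.Base using (_×_; _,_; ∃; proj₁; proj₂; uncurry)
open import Data.Unit.Base using (⊤)
open import Data.Vec.Functional using (Vector)
open import Function.Base using (_∘_; _on_; id)
open import Function.Bundles using (_⇔_; Equivalence)
open import Relation.Binary.Bundles using (Setoid; Poset)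
open import Relation.Binary.Core using (Rel)
open import Relation.Binary.Definitions using (_Respects_)
open import Relation.Binary.Structures using (IsEquivalence)
import Relation.Binary.Construct.On as On
open import Relation.Unary using (Pred; _∈_; _⊆_)
open import Relation.Unary.Relation.Binary.Subset using (⊆-poset)

-- The universe level ℓ plays the role of "small": carriers, truth values of
-- subsets and relations, and index types of families all live in Set ℓ.

-- Σ n is the set of n-ary operation symbols.
Signature : (ℓ : Level) → Set (suc ℓ)
Signature ℓ = ℕ → Set ℓ

data Term {ℓ} (Σ : Signature ℓ) (X : Set) : Set ℓ where
  var  : X → Term Σ X
  node : ∀ {n} → Σ n → Vector (Term Σ X) n → Term Σ X

Operations : ∀ {ℓ} → Signature ℓ → Set ℓ → Set ℓ
Operations Σ A = ∀ {n} → Σ n → Vector A n → A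

-- Evaluation depends on the operations only, so a structure and its quotients
-- (which share a carrier, see _/_ below) evaluate terms identically.
eval : ∀ {ℓ} {Σ : Signature ℓ} {A : Set ℓ} {X : Set} →
       Operations Σ A → Term Σ X → (X → A) → A
eval op (var x)     v = v x
eval op (node f ts) v = op f (λ i → eval op (ts i) v)

record Structure {ℓ} (Σ : Signature ℓ) : Set (suc ℓ) where
  field
    setoid : Setoid ℓ ℓ
  open Setoid setoid public
  field
    op      : Operations Σ Carrier
    op-cong : ∀ {n} (f : Σ n) {xs ys : Vector Carrier n} →
              (∀ i → xs i ≈ ys i) → op f xs ≈ op f ys

∣_∣ : ∀ {ℓ} {Σ : Signature ℓ} → Structure Σ → Set ℓ
∣ M ∣ = Structure.Carrier M

record Hom {ℓ} {Σ : Signature ℓ} (M N : Structure Σ) : Set ℓ where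
  private
    module M = Structure M
    module N = Structure N
  field
    map  : ∣ M ∣ → ∣ N ∣
    cong : ∀ {x y} → x M.≈ y → map x N.≈ map y
    homo : ∀ {n} (f : Σ n) (xs : Vector ∣ M ∣ n) →
           map (M.op f xs) N.≈ N.op f (map ∘ xs)

infix 4 _≗ₕ_

_≗ₕ_ : ∀ {ℓ} {Σ : Signature ℓ} {M N : Structure Σ} → Rel (Hom M N) ℓ
_≗ₕ_ {N = N} g h = ∀ x → Structure._≈_ N (Hom.map g x) (Hom.map h x)

idₕ : ∀ {ℓ} {Σ : Signature ℓ} (M : Structure Σ) → Hom M M
idₕ M = record { map = id ; cong = id ; homo = λ _ _ → Structure.refl M }

infixr 9 _∘ₕ_

_∘ₕ_ : ∀ {ℓ} {Σ : Signature ℓ} {L M N : Structure Σ} →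
       Hom M N → Hom L M → Hom L N
_∘ₕ_ {N = N} g h = record
  { map  = Hom.map g ∘ Hom.map h
  ; cong = Hom.cong g ∘ Hom.cong h
  ; homo = λ f xs → Structure.trans N (Hom.cong g (Hom.homo h f xs))
                                      (Hom.homo g f (Hom.map h ∘ xs))
  }

record QuasiIdentity {ℓ} (Σ : Signature ℓ) : Set ℓ where
  field
    premises   : List (Term Σ ℕ × Term Σ ℕ)
    conclusion : Term Σ ℕ × Term Σ ℕ

infix 4 _⊨_

_⊨_ : ∀ {ℓ} {Σ : Signature ℓ} → Structure Σ → QuasiIdentity Σ → Set ℓ
_⊨_ {Σ = Σ} M q = ∀ v → All (Holds v) premises → Holds v conclusion
  where
  open Structure M
  open QuasiIdentity q
  Holds : (ℕ → Carrier) → Term Σ ℕ × Term Σ ℕ → Set _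
  Holds v (s , t) = eval op s v ≈ eval op t v

IsQuasivariety : ∀ {ℓ κ} {Σ : Signature ℓ} → Pred (Structure Σ) κ → Set (suc ℓ ⊔ κ)
IsQuasivariety {ℓ} {Σ = Σ} K =
  ∃ λ (Q : Pred (QuasiIdentity Σ) ℓ) → ∀ M → M ∈ K ⇔ (∀ q → q ∈ Q → M ⊨ q)

record IsCongruence {ℓ} {Σ : Signature ℓ} (M : Structure Σ) (θ : Rel ∣ M ∣ ℓ) : Set ℓ where
  open Structure M using (Carrier; _≈_; op)
  field
    isEquivalence : IsEquivalence θ
    reflexive     : ∀ {x y} → x ≈ y → θ x y
    compatible    : ∀ {n} (f : Σ n) {xs ys : Vector Carrier n} →
                    (∀ i → θ (xs i) (ys i)) → θ (op f xs) (op f ys)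

-- The quotient keeps the carrier and takes θ as its equality.
_/_ : ∀ {ℓ} {Σ : Signature ℓ} (M : Structure Σ) {θ : Rel ∣ M ∣ ℓ} →
      IsCongruence M θ → Structure Σ
M / c = record
  { setoid  = record { isEquivalence = IsCongruence.isEquivalence c }
  ; op      = Structure.op M
  ; op-cong = IsCongruence.compatible c
  }

record Congruence {ℓ κ} {Σ : Signature ℓ} (K : Pred (Structure Σ) κ)
                  (M : Structure Σ) : Set (suc ℓ ⊔ κ) where
  field
    rel          : Rel ∣ M ∣ ℓ
    isCongruence : IsCongruence M rel
    quotient∈K   : (M / isCongruence) ∈ K

Co : ∀ {ℓ κ} {Σ : Signature ℓ} → Pred (Structure Σ) κ →
     Structure Σ → Poset (suc ℓ ⊔ κ) ℓ ℓ
Co {ℓ} K M = On.poset {B = Congruence K M} (⊆-poset (∣ M ∣ × ∣ M ∣) ℓ)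
                      (uncurry ∘ Congruence.rel)

module _ {ℓ} {Σ : Signature ℓ} {M N : Structure Σ} (h : Hom M N) where
  private
    module M = Structure M
    module N = Structure N
  open Hom h

  map-eval : ∀ {X : Set} (t : Term Σ X) (v : X → ∣ M ∣) →
             map (eval M.op t v) N.≈ eval N.op t (map ∘ v)
  map-eval (var x)     v = N.refl
  map-eval (node f ts) v =
    N.trans (homo f _) (N.op-cong f (λ i → map-eval (ts i) v))

  ⊨-reflect : (∀ {x y} → map x N.≈ map y → x M.≈ y) →
              ∀ q → N ⊨ q → M ⊨ q
  ⊨-reflect injective q N⊨q v prems =
    injective (from (QuasiIdentity.conclusion q)
                    (N⊨q (map ∘ v) (All.map (λ {e} → to e) prems)))
    where
    to : ∀ e → eval M.op (proj₁ e) v M.≈ eval M.op (proj₂ e) v →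
         eval N.op (proj₁ e) (map ∘ v) N.≈ eval N.op (proj₂ e) (map ∘ v)
    to (s , t) eq =
      N.trans (N.sym (map-eval s v)) (N.trans (cong eq) (map-eval t v))
    from : ∀ e → eval N.op (proj₁ e) (map ∘ v) N.≈ eval N.op (proj₂ e) (map ∘ v) →
           map (eval M.op (proj₁ e) v) N.≈ map (eval M.op (proj₂ e) v)
    from (s , t) eq =
      N.trans (map-eval s v) (N.trans eq (N.sym (map-eval t v)))

  pullback-isCongruence : ∀ {θ} → IsCongruence N θ → IsCongruence M (θ on map)
  pullback-isCongruence c = record
    { isEquivalence = On.isEquivalence map isEquivalence
    ; reflexive     = reflexive ∘ cong
    ; compatible    = λ f {xs} {ys} eqs →
        trans (reflexive (homo f xs))
          (trans (compatible f eqs) (sym (reflexive (homo f ys))))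
    }
    where
    open IsCongruence c
    open IsEquivalence isEquivalence using (sym; trans)

  pullback-hom : ∀ {θ} (c : IsCongruence N θ) →
                 Hom (M / pullback-isCongruence c) (N / c)
  pullback-hom c = record
    { map  = map
    ; cong = id
    ; homo = λ f xs → IsCongruence.reflexive c (homo f xs)
    }

-- Co₁ K qv h = (h × h)⁻¹; membership of M / (h × h)⁻¹(θ) in K is where the
-- quasivariety hypothesis enters.
Co₁ : ∀ {ℓ κ} {Σ : Signature ℓ} (K : Pred (Structure Σ) κ) → IsQuasivariety K →
      ∀ {M N : Structure Σ} → Hom M N → Congruence K N → Congruence K M
Co₁ K (Q , axiomatizes) {M} {N} h θ = record
  { rel          = rel on Hom.map h
  ; isCongruence = pullback-isCongruence h isCongruence
  ; quotient∈K   = Equivalence.from (axiomatizes _) λ q q∈Q →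
      ⊨-reflect (pullback-hom h isCongruence) id q
        (Equivalence.to (axiomatizes _) quotient∈K q q∈Q)
  }
  where open Congruence θ

-- Subsets of a carrier-with-equality are the predicates respecting ≈.
record Subset {ℓ} {Σ : Signature ℓ} (M : Structure Σ) : Set (suc ℓ) where
  field
    pred     : Pred ∣ M ∣ ℓ
    respects : pred Respects (Structure._≈_ M)

𝒫 : ∀ {ℓ} {Σ : Signature ℓ} → Structure Σ → Poset (suc ℓ) ℓ ℓ
𝒫 {ℓ} M = On.poset {B = Subset M} (⊆-poset ∣ M ∣ ℓ) Subset.pred

infix 10 _⁻¹[_]

_⁻¹[_] : ∀ {ℓ} {Σ : Signature ℓ} {M N : Structure Σ} → Hom M N → Subset N → Subset M
h ⁻¹[ S ] = record
  { pred     = Subset.pred S ∘ Hom.map h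
  ; respects = Subset.respects S ∘ Hom.cong h
  }

module _ {p ℓ₁ ℓ₂} (P : Poset p ℓ₁ ℓ₂) where
  open Poset P

  IsInfimum : ∀ {ℓ} {I : Set ℓ} → (I → Carrier) → Carrier → Set _
  IsInfimum s x = (∀ i → x ≤ s i) × (∀ y → (∀ i → y ≤ s i) → y ≤ x)

  IsSupremum : ∀ {ℓ} {I : Set ℓ} → (I → Carrier) → Carrier → Set _
  IsSupremum s x = (∀ i → s i ≤ x) × (∀ y → (∀ i → s i ≤ y) → x ≤ y)

  IsDirected : ∀ {ℓ} {I : Set ℓ} → (I → Carrier) → Set _
  IsDirected {I = I} s = I × (∀ i j → ∃ λ k → s i ≤ s k × s j ≤ s k)

  -- Compactness in its directed form: c is inaccessible by directed suprema.
  IsCompact : (ℓ : Level) → Carrier → Set _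
  IsCompact ℓ c = ∀ {I : Set ℓ} (s : I → Carrier) → IsDirected s →
                  ∀ x → IsSupremum s x → c ≤ x → ∃ λ i → c ≤ s i

  record IsAlgebraicLattice (ℓ : Level) : Set (p ⊔ ℓ₁ ⊔ ℓ₂ ⊔ suc ℓ) where
    field
      infima    : ∀ {I : Set ℓ} (s : I → Carrier) → ∃ (IsInfimum s)
      suprema   : ∀ {I : Set ℓ} (s : I → Carrier) → ∃ (IsSupremum s)
      algebraic : ∀ x → ∃ λ (I : Set ℓ) → ∃ λ (s : I → Carrier) →
                  (∀ i → IsCompact ℓ (s i)) × IsSupremum s x

-- Monotonicity and compatibility with ≈ follow from preservation of infima.
record IsALMorphism (ℓ : Level) {p p₁ p₂ q q₁ q₂}
                    (P : Poset p p₁ p₂) (Q : Poset q q₁ q₂)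
                    (f : Poset.Carrier P → Poset.Carrier Q) :
                    Set (p ⊔ p₁ ⊔ p₂ ⊔ q ⊔ q₁ ⊔ q₂ ⊔ suc ℓ) where
  field
    preserves-infima           : ∀ {I : Set ℓ} (s : I → Poset.Carrier P) x →
                                 IsInfimum P s x → IsInfimum Q (f ∘ s) (f x)
    preserves-directed-suprema : ∀ {I : Set ℓ} (s : I → Poset.Carrier P) →
                                 IsDirected P s → ∀ x →
                                 IsSupremum P s x → IsSupremum Q (f ∘ s) (f x)

module _ {ℓ} {Σ : Signature ℓ} {p p₁ p₂}
         (G : Structure Σ → Poset p p₁ p₂)
         (G₁ : ∀ {M N} → Hom M N → Poset.Carrier (G N) → Poset.Carrier (G M)) where

  record IsContravariantFunctorToAL : Set (suc ℓ ⊔ p ⊔ p₁ ⊔ p₂) where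
    field
      isAlgebraicLattice : ∀ M → IsAlgebraicLattice (G M) ℓ
      isALMorphism       : ∀ {M N} (h : Hom M N) → IsALMorphism ℓ (G N) (G M) (G₁ h)
      respects           : ∀ {M N} {g h : Hom M N} → g ≗ₕ h → ∀ x →
                           Poset._≈_ (G M) (G₁ g x) (G₁ h x)
      identity           : ∀ {M} x → Poset._≈_ (G M) (G₁ (idₕ M) x) x
      composition        : ∀ {L M N} (g : Hom M N) (h : Hom L M) x →
                           Poset._≈_ (G L) (G₁ (g ∘ₕ h) x) (G₁ h (G₁ g x))

  record IsFilterPair (i : ∀ M → Poset.Carrier (G M) → Subset M) :
                      Set (suc ℓ ⊔ p ⊔ p₁ ⊔ p₂) where
    field
      isFunctor : IsContravariantFunctorToAL
      preserves : ∀ M → IsALMorphism ℓ (G M) (𝒫 M) (i M)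
      natural   : ∀ {M N} (h : Hom M N) x →
                  Poset._≈_ (𝒫 M) (i M (G₁ h x)) (h ⁻¹[ i N x ])

Equation : ∀ {ℓ} → Signature ℓ → Set ℓ
Equation Σ = Term Σ ⊤ × Term Σ ⊤

-- τ^M(m) ⊆ M × M, as a subset of a carrier with equality ≈.
_^_⟨_⟩ : ∀ {ℓ} {Σ : Signature ℓ} → List (Equation Σ) →
         (M : Structure Σ) → ∣ M ∣ → Pred (∣ M ∣ × ∣ M ∣) ℓ
(τ ^ M ⟨ m ⟩) (a , b) =
  Any (λ (ε , δ) → a ≈ eval op ε (λ _ → m) × b ≈ eval op δ (λ _ → m)) τ
  where open Structure M

i^ : ∀ {ℓ κ} {Σ : Signature ℓ} (K : Pred (Structure Σ) κ) → List (Equation Σ) →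
     (M : Structure Σ) → Congruence K M → Subset M
i^ K τ M θ = record
  { pred     = λ m → τ ^ M ⟨ m ⟩ ⊆ uncurry rel
  ; respects = λ m≈n τm⊆θ → τm⊆θ ∘ Any.map
      (λ {e} (a≈ , b≈) → trans a≈ (eval-cong (proj₁ e) (sym m≈n))
                       , trans b≈ (eval-cong (proj₂ e) (sym m≈n)))
  }
  where
  open Structure M
  open Congruence θ
  eval-cong : ∀ t {m n} → m ≈ n → eval op t (λ _ → m) ≈ eval op t (λ _ → n)
  eval-cong (var _)     m≈n = m≈n
  eval-cong (node f ts) m≈n = op-cong f (λ i → eval-cong (ts i) m≈n)

{-# OPTIONS --safe #-}
-- Meets in Co_K(M) are intersections.  Since operations are finitary and
-- quasi-identities have finitely many premises, directed joins are unions, so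
-- K-congruences generated by a single pair are compact, and every K-congruence
-- is the join of the ones generated by its pairs.  Preimages commute with
-- intersections and unions; for i^τ, finiteness of τ lets a single member of
-- the directed family contain all of τ^M(m).
module Submission where

open import Defs
open import Data.Fin.Base using (Fin; zero; suc)
open import Data.List.Base using (List)
open import Data.List.Relation.Unary.All as All using (All; []; _∷_)
open import Data.List.Relation.Unary.Any as Any using ()
open import Data.Nat.Base using (ℕ; zero; suc)
open import Data.Product.Base using (_×_; _,_; ∃; proj₁; proj₂; uncurry; map₂)
open import Function.Base using (_∘_; id)
open import Function.Bundles using (Equivalence)
open import Relation.Binary.Bundles using (Poset)
open import Relation.Binary.Core using (Rel)
open import Relation.Binary.PropositionalEquality.Core using (_≡_; refl)
open import Relation.Binary.Structures using (IsEquivalence)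
open import Relation.Unary using (Pred; _∈_; _⊆_)
open import Relation.Unary.Relation.Binary.Subset using (⊆-poset)

-- Finite selections from directed families of subsets.

module _ {ℓ} {A I : Set ℓ} (P : I → Pred A ℓ) (dir : IsDirected (⊆-poset A ℓ) P) where

  -- Induction on the list: directedness merges the index found for the head with the one found for
  -- the tail, and the index that inhabits `I` serves the empty list. This is where finiteness of
  -- premise lists and of `τ` enters.
  directed-All : ∀ {z} {Z : Set z} (f : Z → A) {zs : List Z} →
                 All (λ z → ∃ λ i → P i (f z)) zs → ∃ λ i → All (P i ∘ f) zs
  directed-All f [] = proj₁ dir , []
  directed-All f ((i , p) ∷ ps) =
    let j , qs        = directed-All f ps
        k , i≤k , j≤k = proj₂ dir i j
    in k , i≤k p ∷ All.map j≤k qs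

  directed-Fin : ∀ n (f : Fin n → A) → (∀ m → ∃ λ i → P i (f m)) →
                 ∃ λ i → ∀ m → P i (f m)
  directed-Fin zero    f ps = proj₁ dir , λ ()
  directed-Fin (suc n) f ps =
    let i , p         = ps zero
        j , qs        = directed-Fin n (f ∘ suc) (ps ∘ suc)
        k , i≤k , j≤k = proj₂ dir i j
    in k , λ { zero → i≤k p ; (suc m) → j≤k (qs m) }

-- The least K-congruence containing `R`, built by closing under the rules. Intersecting all
-- K-congruences above `R` would quantify over a large type and leave level `ℓ`.
data Generated {ℓ} {Σ : Signature ℓ} (Q : Pred (QuasiIdentity Σ) ℓ)
               (M : Structure Σ) (R : Rel ∣ M ∣ ℓ) : Rel ∣ M ∣ ℓ where
  base      : ∀ {a b} → R a b → Generated Q M R a b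
  gen-refl  : ∀ {a b} → Structure._≈_ M a b → Generated Q M R a b
  gen-sym   : ∀ {a b} → Generated Q M R a b → Generated Q M R b a
  gen-trans : ∀ {a b c} → Generated Q M R a b → Generated Q M R b c →
              Generated Q M R a c
  gen-op    : ∀ {n} (f : Σ n) {xs ys} →
              (∀ i → Generated Q M R (xs i) (ys i)) →
              Generated Q M R (Structure.op M f xs) (Structure.op M f ys)
  gen-quasi : ∀ q → q ∈ Q → ∀ v →
              All (λ e → Generated Q M R (eval (Structure.op M) (proj₁ e) v)
                                         (eval (Structure.op M) (proj₂ e) v))
                  (QuasiIdentity.premises q) →
              Generated Q M R
                (eval (Structure.op M) (proj₁ (QuasiIdentity.conclusion q)) v)
                (eval (Structure.op M) (proj₂ (QuasiIdentity.conclusion q)) v)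

-- The algebraic lattice of K-congruences.

module _ {ℓ κ} {Σ : Signature ℓ} {K : Pred (Structure Σ) κ}
         (qv : IsQuasivariety K) (M : Structure Σ) where
  private
    module M = Structure M
    Q : Pred (QuasiIdentity Σ) ℓ
    Q = proj₁ qv
    module θ (θ : Congruence K M) where
      open Congruence θ public
      open IsCongruence isCongruence public
      open IsEquivalence isEquivalence public using (refl; sym; trans)

  -- A quotient evaluates terms as `M` does, so satisfaction of `q` unfolds to closure of `θ` under
  -- the instances of `q`.
  quotient-⊨ : ∀ (θ : Congruence K M) q → q ∈ Q → M / Congruence.isCongruence θ ⊨ q
  quotient-⊨ θ = Equivalence.to (proj₂ qv _) (Congruence.quotient∈K θ)

  congruence : ∀ {θ : Rel ∣ M ∣ ℓ} (c : IsCongruence M θ) →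
               (∀ q → q ∈ Q → M / c ⊨ q) → Congruence K M
  congruence c ⊨Q = record
    { isCongruence = c ; quotient∈K = Equivalence.from (proj₂ qv _) ⊨Q }

  ⋂ : ∀ {I : Set ℓ} → (I → Congruence K M) → Congruence K M
  ⋂ s = congruence
    {θ = λ a b → ∀ i → θ.rel (s i) a b}
    record
      { isEquivalence = record
        { refl  = λ i → θ.refl (s i)
        ; sym   = λ p i → θ.sym (s i) (p i)
        ; trans = λ p q i → θ.trans (s i) (p i) (q i)
        }
      ; reflexive  = λ p i → θ.reflexive (s i) p
      ; compatible = λ f ps i → θ.compatible (s i) f (λ j → ps j i)
      }
    λ q q∈Q v ps i → quotient-⊨ (s i) q q∈Q v (All.map (λ p → p i) ps)

  ⋂-isInfimum : ∀ {I : Set ℓ} (s : I → Congruence K M) →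
                IsInfimum (Co K M) s (⋂ s)
  ⋂-isInfimum s = (λ i p → p i) , λ y y≤s p i → y≤s i p

  -- Each closure condition has finitely many hypotheses, and directedness puts them all into one
  -- member: two for transitivity, the arity many for an operation, the premises for a
  -- quasi-identity.
  ⋃ : ∀ {I : Set ℓ} (s : I → Congruence K M) → IsDirected (Co K M) s →
      Congruence K M
  ⋃ {I} s dir = congruence
    {θ = λ a b → ∃ λ i → θ.rel (s i) a b}
    record
      { isEquivalence = record
        { refl  = proj₁ dir , θ.refl (s (proj₁ dir))
        ; sym   = map₂ λ {i} → θ.sym (s i)
        ; trans = λ (i , p) (j , q) →
            let k , i≤k , j≤k = proj₂ dir i j
            in k , θ.trans (s k) (i≤k p) (j≤k q)
        }
      ; reflexive  = λ p → proj₁ dir , θ.reflexive (s (proj₁ dir)) p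
      ; compatible = λ {n} f {xs} {ys} ps →
          map₂ (λ {i} → θ.compatible (s i) f)
               (directed-Fin rels dir n (λ j → xs j , ys j) ps)
      }
    λ q q∈Q v ps →
      map₂ (λ {i} → quotient-⊨ (s i) q q∈Q v)
           (directed-All rels dir
             (λ e → eval M.op (proj₁ e) v , eval M.op (proj₂ e) v) ps)
    where
    rels : I → Pred (∣ M ∣ × ∣ M ∣) ℓ
    rels i = uncurry (θ.rel (s i))

  -- An infimum is known only by its universal property; comparison with `⋂ s` makes it readable
  -- pair by pair.
  ⋂-greatest : ∀ {I : Set ℓ} (s : I → Congruence K M) x → IsInfimum (Co K M) s x →
               ∀ {a b} → (∀ i → θ.rel (s i) a b) → θ.rel x a b
  ⋂-greatest s x (_ , greatest) = greatest (⋂ s) (λ i p → p i)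

  directed-supremum⊆⋃ : ∀ {I : Set ℓ} (s : I → Congruence K M) →
                        IsDirected (Co K M) s → ∀ x → IsSupremum (Co K M) s x →
                        ∀ {a b} → θ.rel x a b → ∃ λ i → θ.rel (s i) a b
  directed-supremum⊆⋃ s dir x (_ , least) = least (⋃ s dir) (λ i p → i , p)

  ⟨_⟩ : Rel ∣ M ∣ ℓ → Congruence K M
  ⟨ R ⟩ = congruence {θ = Generated Q M R}
    record
      { isEquivalence = record
        { refl = gen-refl M.refl ; sym = gen-sym ; trans = gen-trans }
      ; reflexive  = gen-refl
      ; compatible = gen-op
      }
    gen-quasi

  module _ {R : Rel ∣ M ∣ ℓ} (θ : Congruence K M)
           (R⊆θ : ∀ {a b} → R a b → θ.rel θ a b) where
    mutual
      ⟨⟩-least : ∀ {a b} → Generated Q M R a b → θ.rel θ a b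
      ⟨⟩-least (base p)               = R⊆θ p
      ⟨⟩-least (gen-refl p)           = θ.reflexive θ p
      ⟨⟩-least (gen-sym p)            = θ.sym θ (⟨⟩-least p)
      ⟨⟩-least (gen-trans p q)        = θ.trans θ (⟨⟩-least p) (⟨⟩-least q)
      ⟨⟩-least (gen-op f ps)          = θ.compatible θ f (λ i → ⟨⟩-least (ps i))
      ⟨⟩-least (gen-quasi q q∈Q v ps) = quotient-⊨ θ q q∈Q v (⟨⟩-least-All v ps)

      -- Written out in place of `All.map` so that the recursion on the premises is visibly
      -- structural.
      ⟨⟩-least-All : ∀ v {es : List (Term Σ ℕ × Term Σ ℕ)} →
        All (λ e → Generated Q M R (eval M.op (proj₁ e) v) (eval M.op (proj₂ e) v)) es →
        All (λ e → θ.rel θ (eval M.op (proj₁ e) v) (eval M.op (proj₂ e) v)) es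
      ⟨⟩-least-All v []       = []
      ⟨⟩-least-All v (p ∷ ps) = ⟨⟩-least p ∷ ⟨⟩-least-All v ps

  principal : ∣ M ∣ × ∣ M ∣ → Congruence K M
  principal (a , b) = ⟨ (λ x y → (x , y) ≡ (a , b)) ⟩

  principal-least : ∀ (θ : Congruence K M) {a b} → θ.rel θ a b →
                    Poset._≤_ (Co K M) (principal (a , b)) θ
  principal-least θ p = ⟨⟩-least θ λ { refl → p }

  -- The generating pair lies in a directed union, hence in one member, and that member then
  -- contains everything the pair generates.
  principal-isCompact : ∀ ab → IsCompact (Co K M) ℓ (principal ab)
  principal-isCompact ab s dir x sup ab≤x =
    map₂ (λ {i} → principal-least (s i))
         (directed-supremum⊆⋃ s dir x sup (ab≤x (base refl)))

  Co-isAlgebraicLattice : IsAlgebraicLattice (Co K M) ℓ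
  Co-isAlgebraicLattice = record
    { infima    = λ s → ⋂ s , ⋂-isInfimum s
    ; suprema   = λ s →
        ⟨ (λ a b → ∃ λ i → θ.rel (s i) a b) ⟩
        , (λ i p → base (i , p))
        , λ y s≤y → ⟨⟩-least y (λ (i , p) → s≤y i p)
    ; algebraic = λ x →
        -- Indexing by the pairs in `x` keeps the family small, which indexing by all compact
        -- congruences below `x` would not.
        ∃ (uncurry (θ.rel x)) , principal ∘ proj₁
        , principal-isCompact ∘ proj₁
        , (λ (_ , p) → principal-least x p)
        , λ y principal≤y p → principal≤y (_ , p) (base refl)
    }

-- Functoriality of preimages of congruences.

module _ {ℓ κ} {Σ : Signature ℓ} {K : Pred (Structure Σ) κ}
         (qv : IsQuasivariety K) where

  Co₁-isALMorphism : ∀ {M N} (h : Hom M N) →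
                     IsALMorphism ℓ (Co K N) (Co K M) (Co₁ K qv h)
  Co₁-isALMorphism {N = N} h = record
    -- Preimage is precomposition with the map, so the bounds carry over unchanged. The universal
    -- property in `Co K N` does not apply to `y`, which lives on the source of `h`; the pointwise
    -- description does.
    { preserves-infima = λ s x inf →
        (λ i → proj₁ inf i)
        , λ y y≤s p → ⋂-greatest qv N s x inf (λ i → y≤s i p)
    ; preserves-directed-suprema = λ s dir x sup →
        (λ i → proj₁ sup i)
        , λ y s≤y p → let i , q = directed-supremum⊆⋃ qv N s dir x sup p in s≤y i q
    }

  Co₁-respects : ∀ {M N} {g h : Hom M N} → g ≗ₕ h → ∀ x →
                 Poset._≈_ (Co K M) (Co₁ K qv g x) (Co₁ K qv h x)
  Co₁-respects {N = N} g≗h x =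
      (λ {(a , b)} p → trans (reflexive (N.sym (g≗h a))) (trans p (reflexive (g≗h b))))
    , (λ {(a , b)} p → trans (reflexive (g≗h a)) (trans p (reflexive (N.sym (g≗h b)))))
    where
    module N = Structure N
    open IsCongruence (Congruence.isCongruence x)
    open IsEquivalence isEquivalence using (trans)

  Co₁-isFunctor : IsContravariantFunctorToAL (Co K) (Co₁ K qv)
  Co₁-isFunctor = record
    { isAlgebraicLattice = Co-isAlgebraicLattice qv
    ; isALMorphism       = Co₁-isALMorphism
    ; respects           = λ {_} {_} {g} {h} → Co₁-respects {g = g} {h = h}
    ; identity           = λ _ → id , id
    ; composition        = λ _ _ _ → id , id
    }

-- Solution sets of `τ` as finite conjunctions.

Solves : ∀ {ℓ κ} {Σ : Signature ℓ} {K : Pred (Structure Σ) κ} (M : Structure Σ) →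
         Congruence K M → ∣ M ∣ → Pred (Equation Σ) ℓ
Solves M θ m (ε , δ) =
  Congruence.rel θ (eval (Structure.op M) ε (λ _ → m)) (eval (Structure.op M) δ (λ _ → m))

module _ {ℓ κ} {Σ : Signature ℓ} {K : Pred (Structure Σ) κ}
         (τ : List (Equation Σ)) (M : Structure Σ) (θ : Congruence K M) {m : ∣ M ∣} where
  private
    module M = Structure M
  open IsCongruence (Congruence.isCongruence θ)
  open IsEquivalence isEquivalence using (trans)

  -- Trades a quantifier over pairs of elements for a conjunction over the list `τ`, the form that
  -- `directed-All` accepts. The values of the two terms are themselves a pair in `τ ^ M ⟨ m ⟩`.
  i^⇒All : τ ^ M ⟨ m ⟩ ⊆ uncurry (Congruence.rel θ) → All (Solves M θ m) τ
  i^⇒All τm⊆θ =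
    All.tabulate λ e∈τ → τm⊆θ (Any.map (λ { refl → M.refl , M.refl }) e∈τ)

  -- A pair of `τ ^ M ⟨ m ⟩` equals the values of some equation only up to `≈`, which `θ` absorbs.
  All⇒i^ : All (Solves M θ m) τ → τ ^ M ⟨ m ⟩ ⊆ uncurry (Congruence.rel θ)
  All⇒i^ solves τm∋ab = All.lookupWith
    (λ p (a≈ , b≈) → trans (reflexive a≈) (trans p (reflexive (M.sym b≈))))
    solves τm∋ab

module _ {ℓ κ} {Σ : Signature ℓ} {K : Pred (Structure Σ) κ}
         (qv : IsQuasivariety K) (τ : List (Equation Σ)) where

  i^-isALMorphism : ∀ M → IsALMorphism ℓ (Co K M) (𝒫 M) (i^ K τ M)
  i^-isALMorphism M = record
    { preserves-infima = λ s x inf →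
        (λ i τm⊆x τm∋ab → proj₁ inf i (τm⊆x τm∋ab))
        , λ y y⊆s m∈y τm∋ab → ⋂-greatest qv M s x inf (λ i → y⊆s i m∈y τm∋ab)
    ; preserves-directed-suprema = λ s dir x sup →
        (λ i τm⊆s τm∋ab → proj₁ sup i (τm⊆s τm∋ab))
        , λ y s⊆y {m} τm⊆x →
            -- Each equation of `τ` holds at `m` modulo some member of the family; one member then
            -- serves for all of `τ`.
            let i , solves = directed-All (uncurry ∘ Congruence.rel ∘ s) dir
                  (λ e → eval (Structure.op M) (proj₁ e) (λ _ → m)
                       , eval (Structure.op M) (proj₂ e) (λ _ → m))
                  (All.map (λ p → directed-supremum⊆⋃ qv M s dir x sup p)
                           (i^⇒All τ M x τm⊆x))
            in s⊆y i (All⇒i^ τ M (s i) solves)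
    }

  i^-natural : ∀ {M N} (h : Hom M N) x →
               Poset._≈_ (𝒫 M) (i^ K τ M (Co₁ K qv h x)) (h ⁻¹[ i^ K τ N x ])
  i^-natural {M} {N} h x =
      -- Both sides test the same equations, at `h` of a term value on one side and at the term
      -- value of `h m` on the other; `map-eval` identifies the two up to `≈`, hence modulo `x`.
      (λ m∈ → All⇒i^ τ N x (All.map
        (λ {(ε , δ)} p → trans (reflexive (N.sym (map-eval h ε _)))
                               (trans p (reflexive (map-eval h δ _))))
        (i^⇒All τ M (Co₁ K qv h x) m∈)))
    , (λ m∈ → All⇒i^ τ M (Co₁ K qv h x) (All.map
        (λ {(ε , δ)} p → trans (reflexive (map-eval h ε _))
                               (trans p (reflexive (N.sym (map-eval h δ _)))))
        (i^⇒All τ N x m∈)))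
    where
    module N = Structure N
    open IsCongruence (Congruence.isCongruence x)
    open IsEquivalence isEquivalence using (trans)

theorem3p9 : ∀ {ℓ κ} (Σ : Signature ℓ) (K : Pred (Structure Σ) κ) (qv : IsQuasivariety K) (τ : List (Equation Σ)) →
    IsFilterPair (Co K) (Co₁ K qv) (i^ K τ)
theorem3p9 Σ K qv τ = record
  { isFunctor = Co₁-isFunctor qv
  ; preserves = i^-isALMorphism qv τ
  ; natural   = i^-natural qv τ
  }
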